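{- Let $\kappa$ be an initial ordinal. If the ordering of a poset $\mathbf p$ is the intersection of finitely many (at least one) WPO orderings on its vertex set, each of length $\kappa$, then $\mathbf p$ (which is a WPO) has length $\kappa$.
   Context: Orderings are partial orders, seen as sets of ordered pairs; the intersection of orderings on the same set is their set-theoretic intersection. A poset is well partially ordered (WPO) if it is well founded and has no infinite antichain; equivalently all its linear extensions are well orders. The length $\ell(\mathbf p)$ of a WPO $\mathbf p$ is the largest ordinal type of a linear extension of $\mathbf p$ (the maximum exists by de Jongh–Parikh). The length of an ordering is the length of the corresponding poset. An ordinal is initial if it is equal to its cardinality, i.e. it is not equipotent to any smaller ordinal. -}

module Defs where

open import Data.List.Base using (List)
open import Data.List.Membership.Propositional using (_∈_)
open import Data.Product.Base using (Σ; ∃-syntax; _×_)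
open import Function.Bundles using (_⤖_)
open import Induction.WellFounded using (WellFounded)
open import Level using (Level; suc)
open import Relation.Binary.Core using (Rel; _⇒_)
open import Relation.Binary.Morphism.Structures
  using (IsOrderMonomorphism; IsOrderIsomorphism)
open import Relation.Binary.PropositionalEquality.Core using (_≡_; _≢_)
open import Relation.Binary.Structures using (IsPartialOrder; IsTotalOrder)
import Relation.Binary.Construct.NonStrictToStrict as ToStrict
open import Relation.Nullary.Negation.Core using (¬_)
open import Relation.Unary using (Pred; _⊆_)

private
  variable
    ℓ : Level

Strict : {P : Set ℓ} → Rel P ℓ → Rel P ℓ
Strict _≤_ = ToStrict._<_ _≡_ _≤_

------------------------------------------------------------------------
-- Well partial orders

Finite : {P : Set ℓ} → Pred P ℓ → Set ℓ
Finite {P = P} A = Σ (List P) λ xs → A ⊆ (_∈ xs)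

Infinite : {P : Set ℓ} → Pred P ℓ → Set ℓ
Infinite A = ¬ Finite A

Antichain : {P : Set ℓ} → Rel P ℓ → Pred P ℓ → Set ℓ
Antichain _≤_ A = ∀ {x y} → A x → A y → x ≢ y → ¬ (x ≤ y)

record IsWPO {ℓ : Level} {P : Set ℓ} (_≤_ : Rel P ℓ) : Set (suc ℓ) where
  field
    isPartialOrder      : IsPartialOrder _≡_ _≤_
    wellFounded         : WellFounded (Strict _≤_)
    noInfiniteAntichain : (A : Pred P ℓ) → Antichain _≤_ A → ¬ Infinite A

------------------------------------------------------------------------
-- Ordinals, represented by well-ordered sets; equality of ordinals is
-- order isomorphism.

record Ordinal (ℓ : Level) : Set (suc ℓ) where
  infix 4 _≤_
  field
    Carrier      : Set ℓ
    _≤_          : Rel Carrier ℓ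
    isTotalOrder : IsTotalOrder _≡_ _≤_
    wellFounded  : WellFounded (Strict _≤_)

open Ordinal using (Carrier)

-- f is an order isomorphism of α onto an initial segment of β.
record IsSegmentEmbedding {ℓ : Level} (α β : Ordinal ℓ)
                          (f : Carrier α → Carrier β) : Set ℓ where
  field
    isOrderMonomorphism :
      IsOrderMonomorphism _≡_ _≡_ (Ordinal._≤_ α) (Ordinal._≤_ β) f
    downClosed : ∀ {a b} → Ordinal._≤_ β b (f a) → ∃[ a′ ] f a′ ≡ b

infix 4 _≤ₒ_ _<ₒ_

_≤ₒ_ : Ordinal ℓ → Ordinal ℓ → Set ℓ
α ≤ₒ β = ∃[ f ] IsSegmentEmbedding α β f

_<ₒ_ : Ordinal ℓ → Ordinal ℓ → Set ℓ
α <ₒ β = ∃[ f ] IsSegmentEmbedding α β f × (∃[ b ] ∀ a → f a ≢ b)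

IsInitial : Ordinal ℓ → Set (suc ℓ)
IsInitial {ℓ} κ = (α : Ordinal ℓ) → α <ₒ κ → ¬ (Carrier α ⤖ Carrier κ)

------------------------------------------------------------------------
-- Length

record IsLinearExtension {ℓ : Level} {P : Set ℓ} (_≤_ _⊑_ : Rel P ℓ) : Set ℓ where
  field
    isTotalOrder : IsTotalOrder _≡_ _⊑_
    extends      : _≤_ ⇒ _⊑_

HasOrdinalType : {P : Set ℓ} → Rel P ℓ → Ordinal ℓ → Set ℓ
HasOrdinalType _⊑_ α = ∃[ f ] IsOrderIsomorphism _≡_ _≡_ _⊑_ (Ordinal._≤_ α) f

-- Meaningful for WPOs only: linear extensions that are not well orders have
-- no ordinal type, so the upper bound says nothing about them.
record HasLength {ℓ : Level} {P : Set ℓ} (_≤_ : Rel P ℓ) (κ : Ordinal ℓ) : Set (suc ℓ) where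
  field
    attained   : Σ (Rel P ℓ) λ _⊑_ → IsLinearExtension _≤_ _⊑_ × HasOrdinalType _⊑_ κ
    upperBound : ∀ (_⊑_ : Rel P ℓ) → IsLinearExtension _≤_ _⊑_ →
                 ∀ α → HasOrdinalType _⊑_ α → α ≤ₒ κ

-- A linear extension of ≼ᵢ of type κ also extends ≼, so κ is attained, and ≼ is a WPO because the
-- existence of monotone subsequences passes to finite intersections. Suppose now that a linear
-- extension of ≼ is longer than κ, and let b be its κ-th element. Each of the κ elements x before b
-- satisfies b ⋠ x, hence b ⋠ᵢ x for some i. The elements not ≼ᵢ-above b form a down-set of ≼ᵢ; some
-- linear extension of ≼ᵢ lists them before b, so their number is less than κ. Thus κ is a
-- union of finitely many sets of smaller cardinality, which is impossible if κ is initial and has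
-- no maximum. If κ has a maximum, the κ elements before b already yield an injection of κ
-- into a proper initial segment.

module Submission where

open import Defs
open Ordinal using (Carrier)
open import Axiom.DoubleNegationElimination using (em⇒dne)
open import Axiom.ExcludedMiddle using (ExcludedMiddle)
open import Data.Fin.Base as Fin using (Fin; toℕ)
open import Data.Fin.Properties using (toℕ<n; toℕ-injective; <⇒notInjective; ¬∀⟶∃¬)
open import Data.List.Base using (List; []; _∷_)
open import Data.List.Membership.Propositional using (_∈_; _∉_)
open import Data.List.Membership.Propositional.Properties using (finite)
open import Data.List.Relation.Unary.Any using (here; there)
open import Data.Nat.Base as ℕ using (ℕ; zero; suc; _≤_; z≤n; s≤s)
open import Data.Nat.DivMod using (_%_; [m+kn]%n≡m%n; m<n⇒m%n≡m)
open import Data.Nat.GeneralisedArithmetic using (fold)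
import Data.Nat.Properties as ℕ
open import Data.Product.Base using (Σ; ∃; ∃-syntax; ∃₂; _×_; _,_; proj₁; proj₂)
open import Data.Sum.Base using (_⊎_; inj₁; inj₂)
open import Function.Base using (_∘_; flip; id)
open import Function.Bundles using (mk↣; mk⤖)
open import Function.Consequences.Propositional using (strictlySurjective⇒surjective)
open import Function.Definitions using (Injective)
open import Function.Properties.Bijection using (sym-≡)
open import Induction.WellFounded using (Acc; acc; WellFounded; module Subrelation)
open import Level using (Level)
open import Relation.Binary.Construct.NonStrictToStrict as ToStrict using ()
open import Relation.Binary.Construct.On as On using ()
open import Relation.Binary.Core using (Rel; _⇔_; _Preserves_⟶_)
open import Relation.Binary.Definitions using (Transitive; Trichotomous; tri<; tri≈; tri>)
open import Relation.Binary.Morphism.Structures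
  using (IsOrderMonomorphism; IsOrderIsomorphism)
open import Relation.Binary.PropositionalEquality.Core
  using (_≡_; _≢_; refl; sym; trans; cong; cong₂; subst; subst₂)
open import Relation.Binary.PropositionalEquality.Properties using (isEquivalence)
open import Relation.Binary.Structures using (IsPartialOrder; IsTotalOrder)
open import Relation.Nullary.Decidable.Core using (Dec; yes; no)
open import Relation.Nullary.Negation.Core using (¬_; contradiction)
open import Relation.Unary using (Pred)

-- Monotone subsequences and well partial orders.

chain : ∀ {a r} {A : Set a} (R : Rel A r) → Transitive R → (h : ℕ → A) →
        (∀ n → R (h n) (h (suc n))) → h Preserves ℕ._<_ ⟶ R
chain R R-trans h step {i} {suc j} i<1+j with ℕ.m≤n⇒m<n∨m≡n (ℕ.s≤s⁻¹ i<1+j)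
... | inj₁ i<j  = R-trans (chain R R-trans h step i<j) (step j)
... | inj₂ refl = step i

Perfect : ∀ {a r} {A : Set a} → Rel A r → Set _
Perfect R = ∀ f → Σ (ℕ → ℕ) λ g →
  (g Preserves ℕ._<_ ⟶ ℕ._<_) × ((f ∘ g) Preserves ℕ._<_ ⟶ R)

-- Subsequences are extracted one relation at a time; what earlier extractions achieved survives
-- because each refinement is itself increasing.
perfect-⋂ : ∀ {a r} {A : Set a} n (R : Fin n → Rel A r) →
            (∀ i → Perfect (R i)) → Perfect (λ x y → ∀ i → R i x y)
perfect-⋂ zero    R perf f = id , id , λ _ ()
perfect-⋂ (suc n) R perf f =
  let g , g-mono , Rg = perf Fin.zero f
      h , h-mono , Rh = perfect-⋂ n (R ∘ Fin.suc) (perf ∘ Fin.suc) (f ∘ g)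
  in g ∘ h , g-mono ∘ h-mono , λ
    { i<j Fin.zero    → Rg (h-mono i<j)
    ; i<j (Fin.suc k) → Rh i<j k }

subsequence : ∀ {q} {Q : ℕ → Set q} → (∀ n → ∃[ m ] n ≤ m × Q m) →
              Σ (ℕ → ℕ) λ g → (g Preserves ℕ._<_ ⟶ ℕ._<_) × (∀ k → Q (g k))
subsequence {Q = Q} unbounded = proj₁ ∘ s , chain ℕ._<_ ℕ.<-trans (proj₁ ∘ s) step , proj₂ ∘ s
  where
  s : ℕ → ∃ Q
  s zero    = let m , _ , q = unbounded 0 in m , q
  s (suc k) = let m , _ , q = unbounded (suc (proj₁ (s k))) in m , q

  step : ∀ n → proj₁ (s n) ℕ.< proj₁ (s (suc n))
  step n = proj₁ (proj₂ (unbounded (suc (proj₁ (s n)))))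

preserves<⇒injective : ∀ {a r} {A : Set a} {R : Rel A r} {f : ℕ → A} →
                       (∀ {x y} → R x y → x ≢ y) → f Preserves ℕ._<_ ⟶ R →
                       Injective _≡_ _≡_ f
preserves<⇒injective R⇒≢ f-mono {i} {j} eq with ℕ.<-cmp i j
... | tri< i<j _ _ = contradiction eq (R⇒≢ (f-mono i<j))
... | tri≈ _ i≡j _ = i≡j
... | tri> _ _ j<i = contradiction (sym eq) (R⇒≢ (f-mono j<i))

module WPO {ℓ : Level} (em : ExcludedMiddle ℓ) {P : Set ℓ} where

  module _ {_≼_ : Rel P ℓ} (isWPO : IsWPO _≼_) where
    open IsWPO isWPO
    open IsPartialOrder isPartialOrder using (reflexive) renaming (trans to ≼-trans)

    -- By well-foundedness, indices with no strictly smaller value later on are unbounded. In a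
    -- sequence without a good pair, the values at these indices form an antichain; they are
    -- distinct, since an equality would be a good pair.
    good : (f : ℕ → P) → ∃₂ λ i j → i ℕ.< j × f i ≼ f j
    good f = em⇒dne em λ bad → noInfiniteAntichain A (antichain bad) λ (xs , A⊆xs) →
      finite (mk↣ (preserves<⇒injective id λ i<j eq →
                bad (_ , _ , proj₁ (proj₂ minimals) i<j , reflexive eq)))
             xs (λ i → A⊆xs (_ , proj₂ (proj₂ minimals) i , refl))
      where
      Minimal : ℕ → Set ℓ
      Minimal j = ∀ {k} → j ℕ.< k → ¬ Strict _≼_ (f k) (f j)

      A : Pred P ℓ
      A x = ∃[ j ] Minimal j × f j ≡ x

      minimal-above : ∀ n → Acc (Strict _≼_) (f n) → ∃[ m ] n ≤ m × Minimal m
      minimal-above n (acc rs) with em {P = ∃[ k ] n ℕ.< k × Strict _≼_ (f k) (f n)}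
      ... | yes (k , n<k , fk≺fn) =
        let m , k≤m , min = minimal-above k (rs fk≺fn)
        in m , ℕ.≤-trans (ℕ.<⇒≤ n<k) k≤m , min
      ... | no ∄k = n , ℕ.≤-refl , λ n<k fk≺fn → ∄k (_ , n<k , fk≺fn)

      minimals : Σ (ℕ → ℕ) λ g → (g Preserves ℕ._<_ ⟶ ℕ._<_) × (∀ k → Minimal (g k))
      minimals = subsequence λ n → minimal-above n (wellFounded (f n))

      antichain : ¬ (∃₂ λ i j → i ℕ.< j × f i ≼ f j) → Antichain _≼_ A
      antichain bad (j , _ , refl) (k , min-k , refl) fj≢fk fj≼fk with ℕ.<-cmp j k
      ... | tri< j<k _ _  = bad (j , k , j<k , fj≼fk)
      ... | tri≈ _ refl _ = fj≢fk refl
      ... | tri> _ _ k<j  = min-k k<j (fj≼fk , fj≢fk)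

    -- If from some `N` on every term has a later term above it, a greedy choice works. Otherwise
    -- terms with no later term above them occur unboundedly often, and a subsequence of these
    -- contradicts `good`.
    wpo⇒perfect : Perfect _≼_
    wpo⇒perfect f with em {P = ∃[ N ] (∀ {m} → N ≤ m → ¬ Terminal m)}
      where
      Terminal : ℕ → Set ℓ
      Terminal i = ∀ j → i ℕ.< j → ¬ (f i ≼ f j)
    ... | yes (N , nonTerminal) =
      proj₁ ∘ s ,
      chain ℕ._<_ ℕ.<-trans (proj₁ ∘ s) (λ k → proj₁ (proj₂ (next (s k)))) ,
      chain _≼_ ≼-trans (f ∘ proj₁ ∘ s) (λ k → proj₂ (proj₂ (next (s k))))
      where
      next : ((m , _) : ∃ (N ≤_)) → ∃[ j ] m ℕ.< j × f m ≼ f j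
      next (m , N≤m) = em⇒dne em λ ∄j →
        nonTerminal N≤m λ j m<j fm≼fj → ∄j (j , m<j , fm≼fj)

      s : ℕ → ∃ (N ≤_)
      s zero    = N , ℕ.≤-refl
      s (suc k) = let j , m<j , _ = next (s k)
                  in j , ℕ.≤-trans (proj₂ (s k)) (ℕ.<⇒≤ m<j)
    ... | no unbounded =
      let g , g-mono , terminal = subsequence λ n → em⇒dne em λ ∄m →
            unbounded (n , λ n≤m t → ∄m (_ , n≤m , t))
          i , j , i<j , fgi≼fgj = good (f ∘ g)
      in contradiction fgi≼fgj (terminal i (g j) (g-mono i<j))

  -- Repeatedly choosing an element of `A` outside the list of earlier choices gives distinct terms;
  -- the first two terms of a monotone subsequence then refute the antichain.
  perfect⇒noInfiniteAntichain : {R : Rel P ℓ} → Perfect R →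
                                (A : Pred P ℓ) → Antichain R A → ¬ Infinite A
  perfect⇒noInfiniteAntichain perf A antichain infinite =
    let g , g-mono , Rg = perf f
    in antichain (proj₁ (proj₂ (next (list (g 0))))) (proj₁ (proj₂ (next (list (g 1)))))
         (λ eq → proj₂ (proj₂ (next (list (g 1))))
           (subst (_∈ list (g 1)) eq (earlier (g-mono (s≤s z≤n)))))
         (Rg (s≤s z≤n))
    where
    next : (xs : List P) → ∃[ x ] A x × x ∉ xs
    next xs = em⇒dne em λ ∄x → infinite
      (xs , λ Ax → em⇒dne em λ x∉xs → ∄x (_ , Ax , x∉xs))

    list : ℕ → List P
    list zero    = []
    list (suc n) = proj₁ (next (list n)) ∷ list n

    f : ℕ → P
    f n = proj₁ (next (list n))

    earlier : ∀ {i j} → i ℕ.< j → f i ∈ list j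
    earlier {i} {suc j} i<1+j with ℕ.m≤n⇒m<n∨m≡n (ℕ.s≤s⁻¹ i<1+j)
    ... | inj₁ i<j  = there (earlier i<j)
    ... | inj₂ refl = here refl

-- Absorbing a finite factor by iterating an injection.

-- For an injection s whose predecessor relation is well founded, every element is s^k r for a unique
-- k and a unique r outside the image of s; sending (s^k r , i) to s^(i + k m) r is an injection
-- A × Fin m → A.
module Spread {a} (em : ExcludedMiddle a) {A : Set a} (s : A → A)
              (s-injective : Injective _≡_ _≡_ s)
              (s-wellFounded : WellFounded (λ x y → s x ≡ y)) where

  Root : A → Set a
  Root r = ∀ x → s x ≢ r

  Origin : A → Set a
  Origin x = ∃₂ λ r k → Root r × fold r s k ≡ x

  origin : ∀ x → Origin x
  origin x = go x (s-wellFounded x)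
    where
    go : ∀ x → Acc (λ x y → s x ≡ y) x → Origin x
    go x (acc rs) with em {P = ∃[ y ] s y ≡ x}
    ... | no  root       = x , 0 , (λ y sy≡x → root (y , sy≡x)) , refl
    ... | yes (y , sy≡x) =
      let r , k , root , eq = go y (rs sy≡x)
      in r , suc k , root , trans (cong s eq) sy≡x

  origin-unique : ∀ {r r′} k k′ → Root r → Root r′ →
                  fold r s k ≡ fold r′ s k′ → r ≡ r′ × k ≡ k′
  origin-unique zero    zero     _    _     eq = eq , refl
  origin-unique zero    (suc k′) root _     eq = contradiction (sym eq) (root _)
  origin-unique (suc k) zero     _    root′ eq = contradiction eq (root′ _)
  origin-unique (suc k) (suc k′) root root′ eq =
    let r≡r′ , k≡k′ = origin-unique k k′ root root′ (s-injective eq)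
    in r≡r′ , cong suc k≡k′

  spread : ∀ m → A × Fin m → A
  spread m (x , i) = let r , k , _ = origin x in fold r s (toℕ i ℕ.+ k ℕ.* m)

  spread-injective : ∀ m p q → spread m p ≡ spread m q → p ≡ q
  spread-injective m@(suc _) (x , i) (y , j) eq =
    let r  , k  , root  , rk≡x   = origin x
        r′ , k′ , root′ , r′k′≡y = origin y
        r≡r′ , pos≡ = origin-unique (toℕ i ℕ.+ k ℕ.* m) (toℕ j ℕ.+ k′ ℕ.* m) root root′ eq
        -- As `toℕ i` is less than `m`, it is the remainder of the exponent modulo `m`; the quotient
        -- is `k`.
        i≡j = trans (sym (m<n⇒m%n≡m (toℕ<n i)))
             (trans (sym ([m+kn]%n≡m%n (toℕ i) k m))
             (trans (cong (_% m) pos≡)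
             (trans ([m+kn]%n≡m%n (toℕ j) k′ m)
                    (m<n⇒m%n≡m (toℕ<n j)))))
        k≡k′ = ℕ.*-cancelʳ-≡ k k′ m (ℕ.+-cancelˡ-≡ (toℕ i) (k ℕ.* m) (k′ ℕ.* m)
                 (trans pos≡ (cong (ℕ._+ k′ ℕ.* m) (sym i≡j))))
    in cong₂ _,_
         (trans (sym rk≡x) (trans (cong₂ (λ r k → fold r s k) r≡r′ k≡k′) r′k′≡y))
         (toℕ-injective i≡j)

  -- Both `x` and its image are iterates of one root, so the property is carried down to the root
  -- and up again.
  spread-closed : ∀ {q} (Q : A → Set q) → (∀ x → Q x → Q (s x)) → (∀ x → Q (s x) → Q x) →
                  ∀ m p → Q (proj₁ p) → Q (spread m p)
  spread-closed Q up down m (x , i) Qx with origin x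
  ... | r , k , _ , refl = ups (toℕ i ℕ.+ k ℕ.* m) (downs k Qx)
    where
    downs : ∀ k → Q (fold r s k) → Q r
    downs zero    q = q
    downs (suc k) q = downs k (down _ q)

    ups : ∀ k → Q r → Q (fold r s k)
    ups zero    q = q
    ups (suc k) q = up _ (ups k q)

-- Initial ordinals and bounded injections.

-- With `B` the complement of the target segment, this is the set on which the Schröder-Bernstein
-- bijection follows `h`; elsewhere it is the identity.
data Orbit {a} {A : Set a} (h : A → A) (B : Pred A a) : Pred A a where
  base : ∀ {z} → B z → Orbit h B z
  step : ∀ {z} → Orbit h B z → Orbit h B (h z)

module OrdinalProperties {ℓ : Level} (em : ExcludedMiddle ℓ) (κ : Ordinal ℓ) where
  open Ordinal κ public using (wellFounded) renaming (Carrier to K; _≤_ to _⊑_)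
  open IsTotalOrder (Ordinal.isTotalOrder κ) public
    using (antisym; total; reflexive; isPartialOrder)
    renaming (refl to ⊑-refl; trans to ⊑-trans)

  infix 4 _⊏_
  _⊏_ : Rel K ℓ
  _⊏_ = Strict _⊑_

  ⊏-trans : Transitive _⊏_
  ⊏-trans = ToStrict.<-trans _≡_ _⊑_ isPartialOrder

  ⊏-⊑-trans : ∀ {x y z} → x ⊏ y → y ⊑ z → x ⊏ z
  ⊏-⊑-trans = ToStrict.<-≤-trans _≡_ _⊑_ sym ⊑-trans antisym (subst (_ ⊑_))

  ⊏⇒⋣ : ∀ {x y} → x ⊏ y → ¬ (y ⊑ x)
  ⊏⇒⋣ = ToStrict.<⇒≱ _≡_ _⊑_ antisym

  ⋢⇒⊐ : ∀ {x y} → ¬ (x ⊑ y) → y ⊏ x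
  ⋢⇒⊐ = ToStrict.≰⇒> _≡_ _⊑_ sym reflexive total

  compare : Trichotomous _≡_ _⊏_
  compare = ToStrict.<-trichotomous _≡_ _⊑_ sym (λ _ _ → em) antisym total

  minimum : {Q : Pred K ℓ} → ∃ Q → ∃[ x ] Q x × (∀ {y} → Q y → x ⊑ y)
  minimum {Q} (x , Qx) = go x (wellFounded x) Qx
    where
    go : ∀ x → Acc _⊏_ x → Q x → ∃[ x ] Q x × (∀ {y} → Q y → x ⊑ y)
    go x (acc rs) Qx with em {P = ∃[ y ] y ⊏ x × Q y}
    ... | yes (y , y⊏x , Qy) = go y (rs y⊏x) Qy
    ... | no  ∄y = x , Qx , λ Qy → em⇒dne em λ x⋢y → ∄y (_ , ⋢⇒⊐ x⋢y , Qy)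

  upperBound : ∀ {n} (f : Fin (suc n) → K) → ∃[ d ] (∀ i → f i ⊑ d)
  upperBound {zero}  f = f Fin.zero , λ { Fin.zero → ⊑-refl }
  upperBound {suc n} f with upperBound (f ∘ Fin.suc)
  ... | d , f⊑d with total (f Fin.zero) d
  ...   | inj₁ f₀⊑d = d , λ { Fin.zero → f₀⊑d ; (Fin.suc i) → f⊑d i }
  ...   | inj₂ d⊑f₀ = f Fin.zero ,
          λ { Fin.zero → ⊑-refl ; (Fin.suc i) → ⊑-trans (f⊑d i) d⊑f₀ }

  Σ-≡ : {t : K} {x y : Σ K λ x → ¬ (t ⊑ x)} → proj₁ x ≡ proj₁ y → x ≡ y
  Σ-≡ refl = refl

  -- ¬ (t ⊑ x) rather than x ⊏ t, because negations are proof irrelevant.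
  segment : K → Ordinal ℓ
  segment t = record
    { Carrier      = Σ K λ x → ¬ (t ⊑ x)
    ; _≤_          = λ x y → proj₁ x ⊑ proj₁ y
    ; isTotalOrder = record
      { isPartialOrder = record
        { isPreorder = record
          { isEquivalence = isEquivalence
          ; reflexive     = λ { refl → ⊑-refl }
          ; trans         = ⊑-trans
          }
        ; antisym = λ x⊑y y⊑x → Σ-≡ (antisym x⊑y y⊑x)
        }
      ; total = λ x y → total (proj₁ x) (proj₁ y)
      }
    ; wellFounded = Subrelation.wellFounded
        (λ (x⊑y , x≢y) → x⊑y , λ eq → x≢y (Σ-≡ eq))
        (On.wellFounded proj₁ wellFounded)
    }

  segment<κ : ∀ t → segment t <ₒ κ
  segment<κ t = proj₁ , record
    { isOrderMonomorphism = record
      { isOrderHomomorphism = record { cong = cong proj₁ ; mono = id }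
      ; injective           = λ { refl → refl }
      ; cancel              = id
      }
    ; downClosed = λ {(a , t⋢a)} {b} b⊑a → (b , λ t⊑b → t⋢a (⊑-trans t⊑b b⊑a)) , refl
    } , t , λ (a , t⋢a) a≡t → t⋢a (reflexive (sym a≡t))

  -- The Schröder–Bernstein argument.
  no-injection-below : IsInitial κ → ∀ t (h : K → K) → Injective _≡_ _≡_ h →
                       ¬ (∀ a → h a ⊏ t)
  no-injection-below initial t h h-injective h⊏t =
    initial (segment t) (segment<κ t)
      (sym-≡ (mk⤖ (φ-injective , strictlySurjective⇒surjective φ-surjective)))
    where
    Shifted : Pred K ℓ
    Shifted = Orbit h (t ⊑_)

    φ : K → Ordinal.Carrier (segment t)
    φ x with em {P = Shifted x}
    ... | yes _        = h x , ⊏⇒⋣ (h⊏t x)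
    ... | no unshifted = x , unshifted ∘ base

    φ-injective : Injective _≡_ _≡_ φ
    φ-injective {x} {y} eq with em {P = Shifted x} | em {P = Shifted y}
    ... | yes _  | yes _  = h-injective (cong proj₁ eq)
    -- A moved point lands in the orbit again, and no fixed point lies there.
    ... | yes Sx | no ¬Sy = contradiction (subst Shifted (cong proj₁ eq) (step Sx)) ¬Sy
    ... | no ¬Sx | yes Sy = contradiction (subst Shifted (sym (cong proj₁ eq)) (step Sy)) ¬Sx
    ... | no _   | no _   = cong proj₁ eq

    φ-shifted : ∀ {x} → Shifted x → proj₁ (φ x) ≡ h x
    φ-shifted {x} Sx with em {P = Shifted x}
    ... | yes _  = refl
    ... | no ¬Sx = contradiction Sx ¬Sx

    φ-unshifted : ∀ {x} → ¬ Shifted x → proj₁ (φ x) ≡ x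
    φ-unshifted {x} ¬Sx with em {P = Shifted x}
    ... | yes Sx = contradiction Sx ¬Sx
    ... | no _   = refl

    φ-surjective : ∀ y → ∃[ x ] φ x ≡ y
    φ-surjective (y , t⋢y) with em {P = Shifted y}
    ... | no ¬Sy              = y , Σ-≡ (φ-unshifted ¬Sy)
    ... | yes (base t⊑y)      = contradiction t⊑y t⋢y
    ... | yes (step {z} Sz)   = z , Σ-≡ (φ-shifted Sz)

  module Successor (unbounded : ∀ x → ∃[ y ] x ⊏ y) where

    succ : K → K
    succ x = proj₁ (minimum (unbounded x))

    x⊏succ : ∀ x → x ⊏ succ x
    x⊏succ x = proj₁ (proj₂ (minimum (unbounded x)))

    succ-least : ∀ {x y} → x ⊏ y → succ x ⊑ y
    succ-least {x} = proj₂ (proj₂ (minimum (unbounded x)))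

    succ-injective : Injective _≡_ _≡_ succ
    succ-injective {x} {y} eq with compare x y
    ... | tri≈ _ x≡y _ = x≡y
    ... | tri< x⊏y _ _ = contradiction (⊑-trans (reflexive (sym eq)) (succ-least x⊏y))
                                       (⊏⇒⋣ (x⊏succ y))
    ... | tri> _ _ y⊏x = contradiction (⊑-trans (reflexive eq) (succ-least y⊏x))
                                       (⊏⇒⋣ (x⊏succ x))

    succ-wellFounded : WellFounded (λ x y → succ x ≡ y)
    succ-wellFounded = Subrelation.wellFounded (λ { refl → x⊏succ _ }) wellFounded

    open Spread em succ succ-injective succ-wellFounded

    -- By induction on d. If d = c + 1, pigeonhole on the n + 1 copies of each a given by spread makes
    -- one of them avoid c; otherwise d is closed under succ and spread embeds d × n into d.
    no-cover-below : IsInitial κ → ∀ n d (h : K → K × Fin n) → Injective _≡_ _≡_ h →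
                     ¬ (∀ a → proj₁ (h a) ⊏ d)
    no-cover-below initial n d = go d (wellFounded d)
      where
      go : ∀ d → Acc _⊏_ d → (h : K → K × Fin n) → Injective _≡_ _≡_ h →
           ¬ (∀ a → proj₁ (h a) ⊏ d)
      go d (acc rs) h h-injective h⊏d with em {P = ∃[ c ] c ⊏ d × (∀ {x} → x ⊏ d → x ⊑ c)}
      ... | yes (c , c⊏d , ⊏d⇒⊑c) =
        go c (rs c⊏d) (h ∘ spread (suc n) ∘ copy)
           (λ {a} {b} eq → cong proj₁ (spread-injective (suc n) (copy a) (copy b)
                                                        (h-injective eq)))
           (λ a → proj₂ (pick a))
        where
        pick : ∀ a → ∃[ i ] proj₁ (h (spread (suc n) (a , i))) ⊏ c
        pick a = em⇒dne em λ none →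
          let at-c : ∀ i → proj₁ (h (spread (suc n) (a , i))) ≡ c
              at-c i = em⇒dne em λ ≢c → none (i , ⊏d⇒⊑c (h⊏d _) , ≢c)
          -- If all copies land on `c`, only their labels distinguish them, but there are `suc n`
          -- copies and `n` labels.
          in <⇒notInjective {f = λ i → proj₂ (h (spread (suc n) (a , i)))} (ℕ.n<1+n n)
               λ {i} {j} eq → cong proj₂ (spread-injective (suc n) (a , i) (a , j)
                 (h-injective (cong₂ _,_ (trans (at-c i) (sym (at-c j))) eq)))

        copy : K → K × Fin (suc n)
        copy a = a , proj₁ (pick a)
      ... | no ∄c = no-injection-below initial d (spread n ∘ h)
        (λ {a} {b} eq → h-injective (spread-injective n (h a) (h b) eq))
        (λ a → spread-closed (_⊏ d) succ⊏d (λ x → ⊏-trans (x⊏succ x)) n (h a) (h⊏d a))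
        where
        succ⊏d : ∀ x → x ⊏ d → succ x ⊏ d
        -- If `d` were at most `succ x`, then `x` would be the largest element below `d`.
        succ⊏d x x⊏d = ⋢⇒⊐ λ d⊑sx → ∄c (x , x⊏d , λ y⊏d → em⇒dne em λ y⋢x →
          ⊏⇒⋣ y⊏d (⊑-trans d⊑sx (succ-least (⋢⇒⊐ y⋢x))))

-- Comparison of well orders.

-- A back-and-forth equivalence: it says that the segments below `a` and `b` are isomorphic, without
-- carrying an isomorphism.
data Matching {ℓ} (α β : Ordinal ℓ) (a : Carrier α) (b : Carrier β) : Set ℓ where
  match : (∀ {a′} → Strict (Ordinal._≤_ α) a′ a →
             ∃[ b′ ] Strict (Ordinal._≤_ β) b′ b × Matching α β a′ b′) →
          (∀ {b′} → Strict (Ordinal._≤_ β) b′ b →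
             ∃[ a′ ] Strict (Ordinal._≤_ α) a′ a × Matching α β a′ b′) →
          Matching α β a b

module Comparison {ℓ : Level} (em : ExcludedMiddle ℓ) where

  matching-sym : ∀ {α β : Ordinal ℓ} {a b} → Matching α β a b → Matching β α b a
  matching-sym {α} {β} {a} = go (Ordinal.wellFounded α a)
    where
    go : ∀ {a b} → Acc (Strict (Ordinal._≤_ α)) a → Matching α β a b → Matching β α b a
    go (acc rs) (match forth back) = match
      (λ b′<b → let a′ , a′<a , m = back b′<b in a′ , a′<a , go (rs a′<a) m)
      (λ a′<a → let b′ , b′<b , m = forth a′<a in b′ , b′<b , go (rs a′<a) m)

  -- If `b` were below `b′`, going back and forth would match some `a′` below `a` with both `b` and
  -- a smaller `b″`, the same situation lower down in `α`.
  matching-≮ : ∀ {α β : Ordinal ℓ} {a b b′} → Acc (Strict (Ordinal._≤_ α)) a →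
               Matching α β a b → Matching α β a b′ → ¬ Strict (Ordinal._≤_ β) b b′
  matching-≮ (acc rs) (match forth _) (match _ back′) b<b′ =
    let a′ , a′<a , m = back′ b<b′
        b″ , b″<b , m′ = forth a′<a
    in matching-≮ (rs a′<a) m′ m b″<b

  matching-functional : ∀ {α β : Ordinal ℓ} {a b b′} →
                        Matching α β a b → Matching α β a b′ → b ≡ b′
  matching-functional {α} {β} {a} {b} {b′} m m′ with OrdinalProperties.compare em β b b′
  ... | tri≈ _ b≡b′ _ = b≡b′
  ... | tri< b<b′ _ _ = contradiction b<b′ (matching-≮ (Ordinal.wellFounded α a) m m′)
  ... | tri> _ _ b′<b = contradiction b′<b (matching-≮ (Ordinal.wellFounded α a) m′ m)

  matching-mono : ∀ {α β : Ordinal ℓ} {a a′ b b′} → Matching α β a b → Matching α β a′ b′ →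
                  Strict (Ordinal._≤_ α) a a′ → Strict (Ordinal._≤_ β) b b′
  matching-mono {β = β} m (match forth _) a<a′ with forth a<a′
  ... | b″ , b″<b′ , m″ =
    subst (λ b → Strict (Ordinal._≤_ β) b _) (matching-functional m″ m) b″<b′

  matching⇒embedding : ∀ {α β : Ordinal ℓ} (f : Carrier α → Carrier β) →
                       (∀ a → Matching α β a (f a)) → IsSegmentEmbedding α β f
  matching⇒embedding {α} {β} f m = record
    { isOrderMonomorphism = record
      { isOrderHomomorphism = record { cong = cong f ; mono = mono }
      ; injective           = injective
      ; cancel              = λ fa≤fa′ → em⇒dne em λ a≰a′ →
          β.⊏⇒⋣ (matching-mono (m _) (m _) (α.⋢⇒⊐ a≰a′)) fa≤fa′
      }
    ; downClosed = downClosed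
    }
    where
    module α = OrdinalProperties em α
    module β = OrdinalProperties em β

    mono : ∀ {a a′} → a α.⊑ a′ → f a β.⊑ f a′
    mono {a} {a′} a≤a′ with em {P = a ≡ a′}
    ... | yes refl = β.⊑-refl
    ... | no a≢a′  = proj₁ (matching-mono (m a) (m a′) (a≤a′ , a≢a′))

    injective : Injective _≡_ _≡_ f
    injective {a} {a′} eq = matching-functional (matching-sym (m a))
      (subst (λ b → Matching β α b a′) (sym eq) (matching-sym (m a′)))

    downClosed : ∀ {a b} → b β.⊑ f a → ∃[ a′ ] f a′ ≡ b
    downClosed {a} {b} b≤fa with em {P = b ≡ f a}
    ... | yes b≡fa = a , sym b≡fa
    ... | no b≢fa with match _ back ← m a =
      let a′ , _ , m′ = back (b≤fa , b≢fa) in a′ , matching-functional (m a′) m′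

  -- If some element of `α` has no partner, let `a*` be the least such. Every `b` then has a partner
  -- below `a*`, and the inverse matching embeds `β` as a segment missing `a*`.
  trichotomy : ∀ (α β : Ordinal ℓ) → α ≤ₒ β ⊎ β <ₒ α
  trichotomy α β with em {P = ∀ a → ∃ (Matching α β a)}
  ... | yes matched = inj₁ (proj₁ ∘ matched , matching⇒embedding _ (proj₂ ∘ matched))
  ... | no ¬matched = inj₂ (g , matching⇒embedding g g-matching , a* ,
                            λ b → proj₂ (proj₁ (proj₂ (onto b (β.wellFounded b)))))
    where
    module α = OrdinalProperties em α
    module β = OrdinalProperties em β

    unmatched : ∃[ a ] ¬ ∃ (Matching α β a)
    unmatched = em⇒dne em λ ∄a → ¬matched λ a → em⇒dne em λ ∄b → ∄a (a , ∄b)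

    least-unmatched : ∃[ a ] ¬ ∃ (Matching α β a) × (∀ {a′} → ¬ ∃ (Matching α β a′) → a α.⊑ a′)
    least-unmatched = α.minimum unmatched

    a* : Carrier α
    a* = proj₁ least-unmatched

    partner : ∀ {a} → a α.⊏ a* → ∃ (Matching α β a)
    partner a<a* = em⇒dne em λ ∄b → α.⊏⇒⋣ a<a* (proj₂ (proj₂ least-unmatched) ∄b)

    onto : ∀ b → Acc β._⊏_ b → ∃[ a ] a α.⊏ a* × Matching α β a b
    -- Otherwise `a*` would match `b`: induction gives the back condition, and `below` the forth
    -- condition.
    onto b (acc rs) = em⇒dne em λ ∄a → proj₁ (proj₂ least-unmatched)
      (b , match (λ a<a* → let b′ , m = partner a<a* in b′ , below ∄a a<a* m , m)
                 (λ b′<b → onto _ (rs b′<b)))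
      where
      below : ¬ (∃[ a ] a α.⊏ a* × Matching α β a b) →
              ∀ {a b′} → a α.⊏ a* → Matching α β a b′ → b′ β.⊏ b
      -- A partner equal to `b` or above it would give `b` a partner below `a*`.
      below ∄a {b′ = b′} a<a* m@(match _ back) with β.compare b′ b
      ... | tri< b′<b _ _ = b′<b
      ... | tri≈ _ refl _ = contradiction (_ , a<a* , m) ∄a
      ... | tri> _ _ b<b′ =
        let a″ , a″<a , m″ = back b<b′
        in contradiction (a″ , α.⊏-trans a″<a a<a* , m″) ∄a

    g : Carrier β → Carrier α
    g b = proj₁ (onto b (β.wellFounded b))

    g-matching : ∀ b → Matching β α b (g b)
    g-matching b = matching-sym (proj₂ (proj₂ (onto b (β.wellFounded b))))

-- Rearranged linear extensions.

-- The linear order _⊑_ rearranged so that everything not above b comes before b.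
module Rearrange {ℓ : Level} (em : ExcludedMiddle ℓ) {P : Set ℓ} {_≼_ _⊑_ : Rel P ℓ}
                 (isPartialOrder : IsPartialOrder _≡_ _≼_)
                 (isLinearExtension : IsLinearExtension _≼_ _⊑_)
                 (⊑-wellFounded : WellFounded (Strict _⊑_)) (b : P) where

  private
    module ≼ = IsPartialOrder isPartialOrder
    module ⊑ = IsTotalOrder (IsLinearExtension.isTotalOrder isLinearExtension)

  infix 4 _⊴_
  -- Lexicographic: first the truth value of `b ≼ x`, false before true, then `⊑`. Given the first
  -- component, the premise of the second says that the truth values agree.
  _⊴_ : Rel P ℓ
  x ⊴ y = (b ≼ x → b ≼ y) × ((b ≼ y → b ≼ x) → x ⊑ y)

  ⊴-isLinearExtension : IsLinearExtension _≼_ _⊴_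
  ⊴-isLinearExtension = record
    { isTotalOrder = record
      { isPartialOrder = record
        { isPreorder = record
          { isEquivalence = isEquivalence
          ; reflexive     = λ { refl → id , λ _ → ⊑.refl }
          ; trans         = λ (x→y , x⊑y) (y→z , y⊑z) →
              y→z ∘ x→y , λ z→x → ⊑.trans (x⊑y (z→x ∘ y→z)) (y⊑z (x→y ∘ z→x))
          }
        ; antisym = λ (x→y , x⊑y) (y→x , y⊑x) → ⊑.antisym (x⊑y y→x) (y⊑x x→y)
        }
      ; total = total
      }
    -- The elements above `b` form an up-set of `≼`, so putting them last respects `≼`.
    ; extends = λ x≼y → flip ≼.trans x≼y , λ _ → IsLinearExtension.extends isLinearExtension x≼y
    }
    where
    total : ∀ x y → x ⊴ y ⊎ y ⊴ x
    total x y with em {P = b ≼ x} | em {P = b ≼ y} | ⊑.total x y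
    ... | yes b≼x | no b⋠y  | _        = inj₂ ((λ _ → b≼x) , λ x→y → contradiction (x→y b≼x) b⋠y)
    ... | no b⋠x  | yes b≼y | _        = inj₁ ((λ _ → b≼y) , λ y→x → contradiction (y→x b≼y) b⋠x)
    ... | yes b≼x | yes b≼y | inj₁ x⊑y = inj₁ ((λ _ → b≼y) , λ _ → x⊑y)
    ... | yes b≼x | yes b≼y | inj₂ y⊑x = inj₂ ((λ _ → b≼x) , λ _ → y⊑x)
    ... | no b⋠x  | no b⋠y  | inj₁ x⊑y = inj₁ ((λ b≼x → contradiction b≼x b⋠x) , λ _ → x⊑y)
    ... | no b⋠x  | no b⋠y  | inj₂ y⊑x = inj₂ ((λ b≼y → contradiction b≼y b⋠y) , λ _ → y⊑x)

  -- A descent from above `b` either stays there and decreases in `⊑`, or enters the lower block for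
  -- good, where every descent is again one in `⊑`.
  ⊴-wellFounded : WellFounded (Strict _⊴_)
  ⊴-wellFounded x = go x (⊑-wellFounded x)
    where
    lower : ∀ {x} → ¬ (b ≼ x) → Acc (Strict _⊑_) x → Acc (Strict _⊴_) x
    lower b⋠x (acc rs) = acc λ ((y→x , y⊑x) , y≢x) →
      lower (b⋠x ∘ y→x) (rs (y⊑x (λ b≼x → contradiction b≼x b⋠x) , y≢x))

    go : ∀ x → Acc (Strict _⊑_) x → Acc (Strict _⊴_) x
    go x (acc rs) = acc λ {y} ((_ , y⊑x) , y≢x) → case y y⊑x y≢x em
      where
      case : ∀ y → ((b ≼ x → b ≼ y) → y ⊑ x) → y ≢ x → Dec (b ≼ y) → Acc (Strict _⊴_) y
      case y y⊑x y≢x (yes b≼y) = go y (rs (y⊑x (λ _ → b≼y) , y≢x))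
      case y y⊑x y≢x (no b⋠y)  = lower b⋠y (⊑-wellFounded y)

  ⋡b⇒⊴b : ∀ {x} → ¬ (b ≼ x) → Strict _⊴_ x b
  ⋡b⇒⊴b b⋠x = ((λ _ → ≼.refl) , λ b→x → contradiction (b→x ≼.refl) b⋠x) ,
              λ { refl → b⋠x ≼.refl }

ordinalType⇒wellFounded : ∀ {ℓ} {P : Set ℓ} {_⊑_ : Rel P ℓ} {κ : Ordinal ℓ} →
                          HasOrdinalType _⊑_ κ → WellFounded (Strict _⊑_)
ordinalType⇒wellFounded {κ = κ} (f , iso) = Subrelation.wellFounded
  (λ (x⊑y , x≢y) → mono x⊑y , x≢y ∘ injective)
  (On.wellFounded f (Ordinal.wellFounded κ))
  where
  open IsOrderIsomorphism iso

-- The extension attaining `κ` is a well order, so its rearrangement around `b` is one too, and the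
-- length bound embeds the latter into `κ`.
not-above-embeds : ∀ {ℓ} → ExcludedMiddle ℓ → {κ : Ordinal ℓ} {P : Set ℓ} {_≼_ : Rel P ℓ} →
                   IsPartialOrder _≡_ _≼_ → HasLength _≼_ κ → ∀ b →
                   Σ (P → Carrier κ) λ f → Injective _≡_ _≡_ f ×
                     (∀ x → ¬ (b ≼ x) → Strict (Ordinal._≤_ κ) (f x) (f b))
not-above-embeds em {κ} po len b =
  f , injective , λ x b⋠x →
    let x⊴b , x≢b = ⋡b⇒⊴b b⋠x in mono x⊴b , x≢b ∘ injective
  where
  open HasLength len
  open Rearrange em po (proj₁ (proj₂ attained))
         (ordinalType⇒wellFounded {κ = κ} (proj₂ (proj₂ attained))) b

  rearranged : Ordinal _
  rearranged = record
    { isTotalOrder = IsLinearExtension.isTotalOrder ⊴-isLinearExtension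
    ; wellFounded  = ⊴-wellFounded
    }

  embedding : rearranged ≤ₒ κ
  embedding = upperBound _⊴_ ⊴-isLinearExtension rearranged (id , record
    { isOrderMonomorphism = record
      { isOrderHomomorphism = record { cong = id ; mono = id }
      ; injective = id
      ; cancel    = id
      }
    ; surjective = λ y → y , id
    })

  f : _ → Carrier κ
  f = proj₁ embedding

  open IsOrderMonomorphism (IsSegmentEmbedding.isOrderMonomorphism (proj₂ embedding))
    using (injective; mono)

-- The covering argument and the length of an intersection.

no-cover : ∀ {ℓ} → ExcludedMiddle ℓ → {κ : Ordinal ℓ} → IsInitial κ →
  {P : Set ℓ} (n : ℕ) (R : Fin (suc n) → Rel P ℓ) →
  (∀ i → IsPartialOrder _≡_ (R i)) → (∀ i → HasLength (R i) κ) →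
  (e : Carrier κ → P) → Injective _≡_ _≡_ e → ∀ b → ¬ (∀ a → ∃[ i ] ¬ R i b (e a))
no-cover em {κ} initial {P} n R po len e e-injective b b⋠e
  with em {P = ∃[ t ] (∀ x → Ordinal._≤_ κ x t)}
... | no ¬max = Successor.no-cover-below unbounded initial (suc n) (proj₁ d)
      (λ a → f (proj₁ (b⋠e a)) (e a) , proj₁ (b⋠e a))
      (λ {a} {a′} eq → e-injective (tagged-injective (proj₁ (b⋠e a)) (proj₁ (b⋠e a′)) eq))
      (λ a → let i , b⋠ea = b⋠e a in ⊏-⊑-trans (proj₂ (proj₂ (small i)) (e a) b⋠ea) (proj₂ d i))
  where
  open OrdinalProperties em κ

  unbounded : ∀ x → ∃[ y ] x ⊏ y
  unbounded x = em⇒dne em λ ∄y → ¬max (x , λ y → em⇒dne em λ y⋢x → ∄y (y , ⋢⇒⊐ y⋢x))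

  small : ∀ i → Σ (P → K) λ f → Injective _≡_ _≡_ f × (∀ x → ¬ R i b x → f x ⊏ f b)
  small i = not-above-embeds em {κ} (po i) (len i) b

  f : Fin (suc n) → P → K
  f i = proj₁ (small i)

  tagged-injective : ∀ {x y} i j → (f i x , i) ≡ (f j y , j) → x ≡ y
  tagged-injective i j eq with refl ← cong proj₂ eq = proj₁ (proj₂ (small i)) (cong proj₁ eq)

  d : ∃[ d ] (∀ i → f i b ⊑ d)
  d = upperBound (λ i → f i b)
-- If κ has a maximum t, then e, transported along the bijection ψ of P with κ, is an injection of κ
-- into itself missing ψ b; exchanging t and ψ b turns it into an injection missing t.
... | yes (t , ⊑t) = no-injection-below initial t (avoid ∘ e)
      (λ {a} {a′} eq → e-injective (avoid-injective (e≢b a) (e≢b a′) eq))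
      (λ a → ⊑t _ , avoid≢t (e≢b a))
  where
  open OrdinalProperties em κ

  e≢b : ∀ a → e a ≢ b
  e≢b a refl = let i , b⋠b = b⋠e a in b⋠b (IsPartialOrder.refl (po i))

  type : HasOrdinalType _ κ
  type = proj₂ (proj₂ (HasLength.attained (len Fin.zero)))

  ψ : P → K
  ψ = proj₁ type

  ψ-injective : Injective _≡_ _≡_ ψ
  ψ-injective = IsOrderIsomorphism.injective (proj₂ type)

  avoid : P → K
  avoid x with em {P = ψ x ≡ t}
  ... | yes _ = ψ b
  ... | no  _ = ψ x

  avoid≢t : ∀ {x} → x ≢ b → avoid x ≢ t
  avoid≢t {x} x≢b eq with em {P = ψ x ≡ t}
  ... | yes ψx≡t = x≢b (ψ-injective (trans ψx≡t (sym eq)))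
  ... | no  ψx≢t = ψx≢t eq

  avoid-injective : ∀ {x y} → x ≢ b → y ≢ b → avoid x ≡ avoid y → x ≡ y
  avoid-injective {x} {y} x≢b y≢b eq with em {P = ψ x ≡ t} | em {P = ψ y ≡ t}
  ... | yes ψx≡t | yes ψy≡t = ψ-injective (trans ψx≡t (sym ψy≡t))
  ... | yes _    | no _     = contradiction (sym (ψ-injective eq)) y≢b
  ... | no _     | yes _    = contradiction (ψ-injective eq) x≢b
  ... | no _     | no _     = ψ-injective eq

corollary1p1 : {ℓ : Level} → ExcludedMiddle ℓ →
    (κ : Ordinal ℓ) → IsInitial κ →
    (P : Set ℓ) (_≼_ : Rel P ℓ) → IsPartialOrder _≡_ _≼_ →
    (n : ℕ) → 1 ≤ n →
    (_≼[_]_ : P → Fin n → P → Set ℓ) →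
    (∀ i → IsWPO (λ x y → x ≼[ i ] y)) →
    (∀ i → HasLength (λ x y → x ≼[ i ] y) κ) →
    _≼_ ⇔ (λ x y → ∀ i → x ≼[ i ] y) →
    IsWPO _≼_ × HasLength _≼_ κ
corollary1p1 em κ initial P _≼_ po (suc n) _ _≼[_]_ wpo len (≼⇒≼ᵢ , ≼ᵢ⇒≼) =
  record
    { isPartialOrder      = po
    ; wellFounded         = Subrelation.wellFounded
        (λ (x≼y , x≢y) → ≼⇒≼ᵢ x≼y Fin.zero , x≢y) (IsWPO.wellFounded (wpo Fin.zero))
    ; noInfiniteAntichain = λ A antichain →
        perfect⇒noInfiniteAntichain perfect A
          (λ Ax Ay x≢y → antichain Ax Ay x≢y ∘ ≼ᵢ⇒≼)
    } ,
  record
    { attained   =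
        let _⊑_ , ext , type = HasLength.attained (len Fin.zero)
        in _⊑_ , record
          { isTotalOrder = IsLinearExtension.isTotalOrder ext
          ; extends      = λ x≼y → IsLinearExtension.extends ext (≼⇒≼ᵢ x≼y Fin.zero)
          } , type
    ; upperBound = upperBound
    }
  where
  open WPO em
  open Comparison em using (trichotomy)

  perfect : Perfect (λ x y → ∀ i → x ≼[ i ] y)
  perfect = perfect-⋂ (suc n) (λ i x y → x ≼[ i ] y) (wpo⇒perfect ∘ wpo)

  upperBound : ∀ (_⊑_ : Rel P _) → IsLinearExtension _≼_ _⊑_ →
               ∀ α → HasOrdinalType _⊑_ α → α ≤ₒ κ
  upperBound _⊑_ ext α (φ , iso) with trichotomy α κ
  ... | inj₁ α≤κ = α≤κ
  -- Any `b′` outside the image of `κ` serves as the bound; it need not be the first one.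
  ... | inj₂ (g , g-embedding , b′ , g≢b′) = contradiction not-above
    (no-cover em {κ} initial n (λ i x y → x ≼[ i ] y) (IsWPO.isPartialOrder ∘ wpo) len
              e e-injective b)
    where
    open IsSegmentEmbedding g-embedding
    module α = OrdinalProperties em α

    φ⁻¹ : Carrier α → P
    φ⁻¹ y = proj₁ (IsOrderIsomorphism.surjective iso y)

    φ-φ⁻¹ : ∀ y → φ (φ⁻¹ y) ≡ y
    φ-φ⁻¹ y = proj₂ (IsOrderIsomorphism.surjective iso y) refl

    e : Carrier κ → P
    e = φ⁻¹ ∘ g

    e-injective : Injective _≡_ _≡_ e
    e-injective {x} {y} eq = IsOrderMonomorphism.injective isOrderMonomorphism
      (trans (sym (φ-φ⁻¹ (g x))) (trans (cong φ eq) (φ-φ⁻¹ (g y))))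

    b : P
    b = φ⁻¹ b′

    b⋠e : ∀ a → ¬ (b ≼ e a)
    b⋠e a b≼ea =
      -- Otherwise `b′` would lie in the image of `g`, which is closed downwards.
      let b′≤ga = subst₂ α._⊑_ (φ-φ⁻¹ b′) (φ-φ⁻¹ (g a))
                    (IsOrderIsomorphism.mono iso (IsLinearExtension.extends ext b≼ea))
          a′ , ga′≡b′ = downClosed b′≤ga
      in g≢b′ a′ ga′≡b′

    not-above : ∀ a → ∃[ i ] ¬ (b ≼[ i ] e a)
    not-above a = ¬∀⟶∃¬ (suc n) _ (λ _ → em) (b⋠e a ∘ ≼ᵢ⇒≼)
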